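{- Let $\Psi$ be a rooted integral gain graph, let $e$ be a link of $\Psi$ that is not a root edge, and let $m$ be an integer. Then $$\chi^{\mathbb Z}_\Psi(m)=\chi^{\mathbb Z}_{\Psi\setminus e}(m)-\chi^{\mathbb Z}_{\Psi/e}(m).$$
   Context: An integral gain graph consists of a graph (loops and multiple edges allowed) and a gain function $\varphi$ assigning an integer to each oriented edge, with $\varphi(e^{ -1})=-\varphi(e)$ when $e^{ -1}$ is $e$ with the opposite orientation. The notation $g e_{ij}$ means an edge with endpoints $v_i,v_j$ whose gain in the direction from $v_i$ to $v_j$ is $g$. A link is an edge with two distinct endpoints. A rooted integral gain graph $\Psi$ is an integral gain graph with a distinguished root vertex $v_0$, such that for each nonroot vertex $v_i$ there is an integer $h_i$ for which the edges between $v_0$ and $v_i$ (root edges) are the edges $g e_{0i}$ with $g\in(-\infty,h_i]\subset\mathbb Z$; there are no other edges at $v_0$. The nonroot vertices and nonroot edges are finite in number. A rooted $m$-coloration of $\Psi$ is an assignment $x$ of integers to the vertices with $x_0=0$, with $x_i\le m$ for every nonroot $v_i$, and with every root edge proper, i.e. $x_i>h_i$ for every nonroot $v_i$. It is proper if moreover $x_j\ne x_i+g$ for every nonroot edge $g e_{ij}$. The number of proper rooted $m$-colorations is $\chi^{\mathbb Z}_\Psi(m)$. $\Psi\setminus e$ is $\Psi$ with the edge $e$ deleted. $\Psi/e$ is defined by top-vertex switching and contraction: orient $e$ from $v_i$ to $v_j$ so that its gain $g=\varphi(e)$ is $\ge 0$; let $\eta_i=g$ and $\eta_k=0$ for all other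 vertices $v_k$ (including $v_j$ and $v_0$); replace the gain $\varphi(f)$ of each edge $f$ oriented from $v_k$ to $v_l$ by $\varphi(f)+\eta_l-\eta_k$ (so $e$ gets gain $0$, and $h_i$ becomes $h_i+g$); then identify $v_i$ and $v_j$ to a single vertex and delete $e$. Other edges joining $v_i$ and $v_j$ become loops. The root edges at the contracted vertex have gain set $(-\infty,\max(h_i+g,h_j)]$. -}

module Defs where

open import Data.Bool.Base using (Bool; true; false; not; if_then_else_)
open import Data.Bool.Properties using (not-involutive)
open import Data.Fin.Base using (Fin; zero; suc; punchIn; punchOut)
import Data.Fin.Properties as Fin
open import Data.Integer.Base using (ℤ; +_; 0ℤ; _+_; _-_; -_; _≤_; _<_; _⊔_; ∣_∣)
import Data.Integer.Properties as ℤ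
open import Data.Integer.Tactic.RingSolver using (solve-∀)
open import Data.List.Base using (List; []; _∷_; length; map; filter; upTo; cartesianProductWith)
open import Data.List.Membership.Propositional using (_∈_)
open import Data.List.Membership.Propositional.Properties
  using (∈-map⁺; ∈-map⁻; ∈-filter⁺; ∈-filter⁻; ∈-upTo⁺; ∈-cartesianProductWith⁺; ∈-cartesianProductWith⁻)
open import Data.List.Relation.Unary.Any using (here)
open import Data.List.Relation.Unary.AllPairs.Core using ([]; _∷_)
import Data.List.Relation.Unary.All as All
open import Data.List.Relation.Unary.Unique.Propositional using (Unique)
import Data.List.Relation.Unary.Unique.Propositional.Properties as Unique
open import Data.Nat.Base as ℕ using (ℕ; zero; suc)
open import Data.Product.Base using (_×_; _,_; proj₁; proj₂)
open import Data.Vec.Base using (Vec; []; _∷_; lookup)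
import Data.Vec.Properties as Vec
open import Function.Base using (_∘_)
open import Relation.Binary.PropositionalEquality
  using (_≡_; _≢_; refl; sym; trans; cong; subst; module ≡-Reasoning)
open import Relation.Nullary.Decidable using (Dec; yes; no; does; ¬?; map′; _×-dec_)
open import Relation.Nullary.Negation using (contradiction)

-- The Boolean selects one of the two orientations; which one is called
-- `false` has no meaning.
Oriented : Set → Set
Oriented E = E × Bool

infix 8 _⁻¹

_⁻¹ : ∀ {E} → Oriented E → Oriented E
(e , b) ⁻¹ = e , not b

-- Loops and multiple edges are allowed, so `tail` and `φ` are otherwise
-- arbitrary.
record GainGraph (V E : Set) : Set where
  field
    tail : Oriented E → V
    φ    : Oriented E → ℤ
    φ-⁻¹ : ∀ a → φ (a ⁻¹) ≡ - φ a

  head : Oriented E → V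
  head a = tail (a ⁻¹)

  IsLink : E → Set
  IsLink e = tail (e , false) ≢ head (e , false)

  -- An orientation of e with gain ≥ 0 (if e has gain 0, both qualify).
  topOrientation : E → Oriented E
  topOrientation e = e , not (does (0ℤ ℤ.≤? φ (e , false)))

  topOrientation-link : ∀ e → IsLink e → tail (topOrientation e) ≢ head (topOrientation e)
  topOrientation-link e link with does (0ℤ ℤ.≤? φ (e , false))
  ... | true  = link
  ... | false = link ∘ sym

-- A rooted integral gain graph with n nonroot vertices and k nonroot edges.
-- The root v₀ is implicit: its edges are exactly one edge g e₀ᵢ for each
-- nonroot vertex i and each g ≤ h i.
record RootedGainGraph (n k : ℕ) : Set where
  field
    nonroot : GainGraph (Fin n) (Fin k)
    h       : Fin n → ℤ

  open GainGraph nonroot public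

open RootedGainGraph

infixl 6 _∖_

_∖_ : ∀ {n k} → RootedGainGraph n (suc k) → Fin (suc k) → RootedGainGraph n k
Ψ ∖ e = record
  { nonroot = record
    { tail = λ (f , b) → tail Ψ (punchIn e f , b)
    ; φ    = λ (f , b) → φ Ψ (punchIn e f , b)
    ; φ-⁻¹ = λ (f , b) → φ-⁻¹ Ψ (punchIn e f , b)
    }
  ; h = h Ψ
  }

private
  switch-neg : ∀ p s t → - p + s - t ≡ - (p + t - s)
  switch-neg = solve-∀

-- Switching by η, extended by η v₀ = 0; hence h i becomes h i + η i.
switch : ∀ {n k} → (Fin n → ℤ) → RootedGainGraph n k → RootedGainGraph n k
switch η Ψ = record
  { nonroot = record
    { tail = tail Ψ
    ; φ    = λ a → φ Ψ a + η (head Ψ a) - η (tail Ψ a)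
    ; φ-⁻¹ = λ { a@(e , b) → begin
        φ Ψ (a ⁻¹) + η (head Ψ (a ⁻¹)) - η (tail Ψ (a ⁻¹))
          ≡⟨ cong (λ c → φ Ψ (a ⁻¹) + η (tail Ψ (e , c)) - η (tail Ψ (a ⁻¹))) (not-involutive b) ⟩
        φ Ψ (a ⁻¹) + η (tail Ψ a) - η (head Ψ a)
          ≡⟨ cong (λ z → z + η (tail Ψ a) - η (head Ψ a)) (φ-⁻¹ Ψ a) ⟩
        - φ Ψ a + η (tail Ψ a) - η (head Ψ a)
          ≡⟨ switch-neg (φ Ψ a) (η (tail Ψ a)) (η (head Ψ a)) ⟩
        - (φ Ψ a + η (head Ψ a) - η (tail Ψ a)) ∎ }
    }
  ; h = λ i → h Ψ i + η i
  }
  where open ≡-Reasoning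

-- The quotient of Fin (suc n) by i ∼ j.  The class of a vertex v ≢ i is
-- named by deleting i from Fin (suc n); the class of i is that of j.
merge : ∀ {n} (i j : Fin (suc n)) → i ≢ j → Fin (suc n) → Fin n
merge i j i≢j v with i Fin.≟ v
... | yes _  = punchOut i≢j
... | no i≢v = punchOut i≢v

-- Parallel root edges with equal gains are merged, so that the gain set at
-- the identified vertex is the union of those at i and j.
identify : ∀ {n k} (i j : Fin (suc n)) → i ≢ j →
           RootedGainGraph (suc n) k → RootedGainGraph n k
identify i j i≢j Ψ = record
  { nonroot = record
    { tail = λ a → merge i j i≢j (tail Ψ a)
    ; φ    = φ Ψ
    ; φ-⁻¹ = φ-⁻¹ Ψ
    }
  ; h = λ w → let v = punchIn i w in
              if does (v Fin.≟ j) then h Ψ i ⊔ h Ψ j else h Ψ v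
  }

-- The existence of a link e forces both index arguments to be positive.
contract : ∀ {n k} (Ψ : RootedGainGraph (suc n) (suc k)) (e : Fin (suc k)) →
           IsLink Ψ e → RootedGainGraph n k
contract Ψ e link = identify i j i≢j (switch η Ψ) ∖ e
  where
  a = topOrientation Ψ e
  i = tail Ψ a
  j = head Ψ a

  i≢j : i ≢ j
  i≢j = topOrientation-link Ψ e link

  η : Fin _ → ℤ
  η v = if does (v Fin.≟ i) then φ Ψ a else 0ℤ

-- Entry 0 is the color of the root and entry suc i that of the nonroot
-- vertex i.
Assignment : ℕ → Set
Assignment n = Vec ℤ (suc n)

record IsRootedColoration {n k} (Ψ : RootedGainGraph n k) (m : ℤ) (x : Assignment n) : Set where
  constructor rooted
  field
    root-zero   : lookup x zero ≡ 0ℤ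
    bounded     : ∀ i → lookup x (suc i) ≤ m
    root-proper : ∀ i g → g ≤ h Ψ i → lookup x (suc i) ≢ lookup x zero + g

IsProper : ∀ {n k} → RootedGainGraph n k → Assignment n → Set
IsProper Ψ x = ∀ a → lookup x (suc (head Ψ a)) ≢ lookup x (suc (tail Ψ a)) + φ Ψ a

IsProperRootedColoration : ∀ {n k} → RootedGainGraph n k → ℤ → Assignment n → Set
IsProperRootedColoration Ψ m x = IsRootedColoration Ψ m x × IsProper Ψ x

record Enumeration {A : Set} (P : A → Set) : Set where
  field
    list     : List A
    unique   : Unique list
    sound    : ∀ {x} → x ∈ list → P x
    complete : ∀ {x} → P x → x ∈ list

  card : ℕ
  card = length list

restrict : {A : Set} {P Q : A → Set} → Enumeration P → (∀ x → Dec (Q x)) →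
           Enumeration (λ x → P x × Q x)
restrict E Q? = record
  { list     = filter Q? list
  ; unique   = Unique.filter⁺ Q? unique
  ; sound    = λ x∈ → let x∈list , q = ∈-filter⁻ Q? x∈ in sound x∈list , q
  ; complete = λ (p , q) → ∈-filter⁺ Q? (complete p) q
  }
  where open Enumeration E

private
  sub-sub : ∀ m x → m - (m - x) ≡ x
  sub-sub = solve-∀

interval : ∀ a m → Enumeration (λ x → a < x × x ≤ m)
interval a m = record
  { list     = filter (a ℤ.<?_) candidates
  ; unique   = Unique.filter⁺ (a ℤ.<?_) {candidates} (Unique.map⁺ below-injective (Unique.upTo⁺ ∣ m - a ∣))
  ; sound    = sound
  ; complete = complete
  }
  where
  below : ℕ → ℤ
  below t = m - + t

  candidates : List ℤ
  candidates = map below (upTo ∣ m - a ∣)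

  below-injective : ∀ {s t} → below s ≡ below t → s ≡ t
  below-injective {s} {t} eq =
    ℤ.+-injective (trans (sym (sub-sub m (+ s))) (trans (cong (λ z → m - z) eq) (sub-sub m (+ t))))

  sound : ∀ {x} → x ∈ filter (a ℤ.<?_) candidates → a < x × x ≤ m
  sound x∈ with ∈-filter⁻ (a ℤ.<?_) {xs = candidates} x∈
  ... | x∈map , a<x with ∈-map⁻ below x∈map
  ...   | t , _ , refl = a<x , ℤ.i-j≤i m (+ t)

  complete : ∀ {x} → a < x × x ≤ m → x ∈ filter (a ℤ.<?_) candidates
  complete {x} (a<x , x≤m) =
    ∈-filter⁺ (a ℤ.<?_) (subst (_∈ candidates) below-t (∈-map⁺ below (∈-upTo⁺ t<))) a<x
    where
    +t : + ∣ m - x ∣ ≡ m - x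
    +t = ℤ.0≤i⇒+∣i∣≡i (ℤ.i≤j⇒0≤j-i x≤m)

    below-t : below ∣ m - x ∣ ≡ x
    below-t = trans (cong (λ z → m - z) +t) (sub-sub m x)

    t< : ∣ m - x ∣ ℕ.< ∣ m - a ∣
    t< = ℤ.drop‿+<+ (begin-strict
      + ∣ m - x ∣ ≡⟨ +t ⟩
      m - x       <⟨ ℤ.+-monoʳ-< m (ℤ.neg-mono-< a<x) ⟩
      m - a       ≡⟨ ℤ.0≤i⇒+∣i∣≡i (ℤ.i≤j⇒0≤j-i (ℤ.<⇒≤ (ℤ.<-≤-trans a<x x≤m))) ⟨
      + ∣ m - a ∣ ∎)
      where open ℤ.≤-Reasoning

box : ∀ {n} (a : Fin n → ℤ) m →
      Enumeration {Vec ℤ n} (λ v → ∀ i → a i < lookup v i × lookup v i ≤ m)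
box {zero} a m = record
  { list     = [] ∷ []
  ; unique   = All.[] ∷ []
  ; sound    = λ _ ()
  ; complete = λ { {[]} _ → here refl }
  }
box {suc n} a m = record
  { list     = cartesianProductWith _∷_ I.list B.list
  ; unique   = Unique.cartesianProductWith⁺ _∷_ Vec.∷-injective I.unique B.unique
  ; sound    = sound
  ; complete = λ { {_ ∷ _} p → ∈-cartesianProductWith⁺ _∷_ (I.complete (p zero)) (B.complete (p ∘ suc)) }
  }
  where
  module I = Enumeration (interval (a zero) m)
  module B = Enumeration (box (a ∘ suc) m)

  sound : ∀ {v} → v ∈ cartesianProductWith _∷_ I.list B.list →
          ∀ i → a i < lookup v i × lookup v i ≤ m
  sound v∈ i with ∈-cartesianProductWith⁻ _∷_ I.list B.list v∈
  sound v∈ zero    | _ , _ , y∈ , w∈ , refl = I.sound y∈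
  sound v∈ (suc i) | _ , _ , y∈ , w∈ , refl = B.sound w∈ i

rootedColorations : ∀ {n k} (Ψ : RootedGainGraph n k) m → Enumeration (IsRootedColoration Ψ m)
rootedColorations Ψ m = record
  { list     = map (0ℤ ∷_) B.list
  ; unique   = Unique.map⁺ Vec.∷-injectiveʳ B.unique
  ; sound    = sound
  ; complete = complete
  }
  where
  module B = Enumeration (box (h Ψ) m)

  sound : ∀ {x} → x ∈ map (0ℤ ∷_) B.list → IsRootedColoration Ψ m x
  sound x∈ with ∈-map⁻ (0ℤ ∷_) x∈
  ... | v , v∈ , refl = rooted refl (proj₂ ∘ B.sound v∈) λ i g g≤h eq →
    ℤ.<⇒≢ (ℤ.≤-<-trans g≤h (proj₁ (B.sound v∈ i))) (sym (trans eq (ℤ.+-identityˡ g)))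

  complete : ∀ {x} → IsRootedColoration Ψ m x → x ∈ map (0ℤ ∷_) B.list
  complete {_ ∷ v} (rooted refl bounded proper) = ∈-map⁺ (0ℤ ∷_) (B.complete λ i →
    ℤ.≰⇒> (λ x≤h → proper i (lookup v i) x≤h (sym (ℤ.+-identityˡ _))) , bounded i)

isProper? : ∀ {n k} (Ψ : RootedGainGraph n k) x → Dec (IsProper Ψ x)
isProper? Ψ x = map′ (λ { p (e , false) → proj₁ (p e) ; p (e , true) → proj₂ (p e) })
                     (λ p e → p (e , false) , p (e , true))
                     (Fin.all? λ e → edge? (e , false) ×-dec edge? (e , true))
  where
  edge? : ∀ a → Dec (lookup x (suc (head Ψ a)) ≢ lookup x (suc (tail Ψ a)) + φ Ψ a)
  edge? a = ¬? (_ ℤ.≟ _)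

properRootedColorations : ∀ {n k} (Ψ : RootedGainGraph n k) m →
                          Enumeration (IsProperRootedColoration Ψ m)
properRootedColorations Ψ m = restrict (rootedColorations Ψ m) (isProper? Ψ)

χᶻ : ∀ {n k} → RootedGainGraph n k → ℤ → ℕ
χᶻ Ψ m = Enumeration.card (properRootedColorations Ψ m)

{-# OPTIONS --safe #-}
module Submission where

-- Let a be e oriented from i to j with gain g ≥ 0. The proper rooted
-- m-colorations of Ψ ∖ e satisfying x j ≢ x i + g are those of Ψ. The others
-- are the images of the proper rooted m-colorations y of Ψ / e under
-- x v = y (class of v) - η v. Since only the color of i is lowered, by g ≥ 0,
-- and x j remains the color of the merged vertex, x is bounded by m exactly
-- when y is: this is why it is the top vertex that is switched.

open import Defs
open import Data.Bool.Base using (true; false; if_then_else_)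
open import Data.Bool.Properties using (not-involutive)
open import Data.Nat.Base as ℕ using (ℕ; suc)
open import Data.Fin.Base using (Fin; zero; suc; punchIn; punchOut)
import Data.Fin.Properties as Fin
open import Data.Integer.Base using (ℤ; +_; 0ℤ; _+_; _-_; -_; _≤_; _<_; nonNegative)
import Data.Integer.Properties as ℤ
open import Data.Integer.Tactic.RingSolver using (solve-∀)
open import Data.List.Base using (length; map; _++_)
open import Data.List.Properties using (length-++; length-map)
open import Data.List.Membership.Propositional using (_∈_)
open import Data.List.Membership.Propositional.Properties
  using (∈-++⁺ˡ; ∈-++⁺ʳ; ∈-++⁻; ∈-map⁺; ∈-map⁻)
open import Data.List.Membership.Propositional.Properties.WithK using (unique∧set⇒bag)
open import Data.List.Relation.Binary.BagAndSetEquality using (∼bag⇒↭)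
open import Data.List.Relation.Binary.Permutation.Propositional.Properties using (↭-length)
import Data.List.Relation.Unary.Unique.Propositional.Properties as Unique
open import Data.Product.Base using (∃-syntax; _×_; _,_; proj₁; proj₂)
open import Data.Sum.Base using (_⊎_; inj₁; inj₂)
open import Data.Vec.Base using (Vec; _∷_; lookup; tabulate)
import Data.Vec.Properties as Vec
open import Function.Base using (_∘_)
open import Function.Bundles using (_⇔_; mk⇔; Equivalence)
open import Function.Definitions using (Injective)
open import Relation.Binary.PropositionalEquality
  using (_≡_; _≢_; _≗_; refl; sym; trans; cong; cong₂; subst; module ≡-Reasoning)
open import Relation.Nullary.Decidable using (Dec; yes; no; does)
open import Relation.Nullary.Negation using (¬_; contradiction)

open RootedGainGraph
open Enumeration using (card)

-- Counting a disjoint union with an injective image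

-- Duplicate-free lists with the same members are permutations of each other, so the order in which
-- each enumeration lists its members is irrelevant. Injectivity of `f` keeps `map f F.list`
-- duplicate-free, and disjointness does the same for the concatenation.
card-disjoint-image :
  {A B : Set} {P R : A → Set} {Q : B → Set}
  (E : Enumeration P) (F : Enumeration Q) (G : Enumeration R)
  (f : B → A) → Injective _≡_ _≡_ f →
  (∀ {y} → Q y → ¬ P (f y)) →
  (∀ x → R x ⇔ (P x ⊎ ∃[ y ] (Q y × x ≡ f y))) →
  card G ≡ card E ℕ.+ card F
card-disjoint-image {P = P} {R} {Q} E F G f f-inj disjoint split = begin
  length G.list                              ≡⟨ ↭-length (∼bag⇒↭ bag) ⟩
  length (E.list ++ map f F.list)            ≡⟨ length-++ E.list ⟩
  length E.list ℕ.+ length (map f F.list)    ≡⟨ cong (length E.list ℕ.+_) (length-map f F.list) ⟩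
  length E.list ℕ.+ length F.list            ∎
  where
  module E = Enumeration E
  module F = Enumeration F
  module G = Enumeration G
  open ≡-Reasoning

  unique : _
  unique = Unique.++⁺ E.unique (Unique.map⁺ f-inj F.unique) λ (x∈E , x∈F) →
    let y , y∈ , eq = ∈-map⁻ f x∈F in
    disjoint (F.sound y∈) (subst P eq (E.sound x∈E))

  join : ∀ {x} → P x ⊎ ∃[ y ] (Q y × x ≡ f y) → x ∈ E.list ++ map f F.list
  join (inj₁ p)              = ∈-++⁺ˡ (E.complete p)
  join (inj₂ (y , q , refl)) = ∈-++⁺ʳ E.list (∈-map⁺ f (F.complete q))

  unjoin : ∀ {x} → x ∈ E.list ++ map f F.list → P x ⊎ ∃[ y ] (Q y × x ≡ f y)
  unjoin x∈ with ∈-++⁻ E.list x∈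
  ... | inj₁ x∈E = inj₁ (E.sound x∈E)
  ... | inj₂ x∈F = let y , y∈ , eq = ∈-map⁻ f x∈F in inj₂ (y , F.sound y∈ , eq)

  bag : _
  bag = unique∧set⇒bag G.unique unique λ {x} → mk⇔
    (join ∘ Equivalence.to (split x) ∘ G.sound)
    (G.complete ∘ Equivalence.from (split x) ∘ unjoin)

-- Classes of identified vertices and their root edges

module _ {n} {i j : Fin (suc n)} (i≢j : i ≢ j) where

  punchIn-merge : ∀ {v} → i ≢ v → punchIn i (merge i j i≢j v) ≡ v
  punchIn-merge {v} i≢v with i Fin.≟ v
  ... | yes i≡v = contradiction i≡v i≢v
  ... | no  i≢v = Fin.punchIn-punchOut i≢v

  -- Tested after the injective `punchIn i`, which sends both names back to `j`, the surviving
  -- representative of the class.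
  merge-identified : merge i j i≢j i ≡ merge i j i≢j j
  merge-identified = Fin.punchIn-injective i _ _ (trans step (sym (punchIn-merge i≢j)))
    where
    step : punchIn i (merge i j i≢j i) ≡ j
    step with i Fin.≟ i
    ... | yes _   = Fin.punchIn-punchOut i≢j
    ... | no  i≢i = contradiction refl i≢i

  merge-punchIn : ∀ w → merge i j i≢j (punchIn i w) ≡ w
  merge-punchIn w =
    Fin.punchIn-injective i _ _ (punchIn-merge (Fin.punchInᵢ≢i i w ∘ sym))

  module _ {k} (Φ : RootedGainGraph (suc n) k) where

    private
      Φ/ : RootedGainGraph n k
      Φ/ = identify i j i≢j Φ

    -- With `h-identify-upper` this makes `h Φ/ w` the maximum of `h Φ` over the class `w`.
    -- Attainment serves to descend to the quotient, the upper bound to lift from it.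
    h-identify-attained : ∀ w → ∃[ v ] (merge i j i≢j v ≡ w × h Φ/ w ≡ h Φ v)
    h-identify-attained w with punchIn i w Fin.≟ j
    ... | no _ = punchIn i w , merge-punchIn w , refl
    ... | yes iw≡j with ℤ.⊔-sel (h Φ i) (h Φ j)
    ...   | inj₁ eq = i , trans merge-identified (trans (cong (merge i j i≢j) (sym iw≡j)) (merge-punchIn w)) , eq
    ...   | inj₂ eq = j , trans (cong (merge i j i≢j) (sym iw≡j)) (merge-punchIn w) , eq

    h-identify-punchIn : ∀ w → h Φ (punchIn i w) ≤ h Φ/ w
    h-identify-punchIn w with punchIn i w Fin.≟ j
    ... | yes iw≡j = subst (λ v → h Φ v ≤ _) (sym iw≡j) (ℤ.i≤j⊔i (h Φ i) (h Φ j))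
    ... | no _     = ℤ.≤-refl

    h-identify-identified : h Φ i ≤ h Φ/ (merge i j i≢j i)
    h-identify-identified
      with punchIn i (merge i j i≢j i) Fin.≟ j
    ... | yes _    = ℤ.i≤i⊔j (h Φ i) (h Φ j)
    ... | no  iw≢j = contradiction (trans (cong (punchIn i) merge-identified) (punchIn-merge i≢j)) iw≢j

    h-identify-upper : ∀ v → h Φ v ≤ h Φ/ (merge i j i≢j v)
    h-identify-upper v = bound (i Fin.≟ v)
      where
      bound : Dec (i ≡ v) → h Φ v ≤ h Φ/ (merge i j i≢j v)
      bound (yes refl) = h-identify-identified
      bound (no  i≢v)  = subst (λ u → h Φ u ≤ h Φ/ (merge i j i≢j v)) (punchIn-merge i≢v)
                               (h-identify-punchIn (merge i j i≢j v))

-- The root has color 0 and its gains to `v` are all integers up to `h Ψ v`, so a smaller color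
-- would itself be the gain of an improper root edge. With the converse `rooted′`, root edges enter
-- only as strict inequalities.
above-h : ∀ {n k} {Ψ : RootedGainGraph n k} {m x} → IsRootedColoration Ψ m x →
          ∀ v → h Ψ v < lookup x (suc v)
above-h {x = _ ∷ c} (rooted refl _ proper) v =
  ℤ.≰⇒> λ c≤h → proper v (lookup c v) c≤h (sym (ℤ.+-identityˡ _))

rooted′ : ∀ {n k} {Ψ : RootedGainGraph n k} {m x} → lookup x zero ≡ 0ℤ →
          (∀ v → lookup x (suc v) ≤ m) → (∀ v → h Ψ v < lookup x (suc v)) →
          IsRootedColoration Ψ m x
rooted′ {x = _ ∷ c} refl bounded above = rooted refl bounded λ v g g≤h eq →
  ℤ.<⇒≢ (ℤ.≤-<-trans g≤h (above v)) (sym (trans eq (ℤ.+-identityˡ g)))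

private
  -+-cancel : ∀ z t → z - t + t ≡ z
  -+-cancel = solve-∀

  +--cancel : ∀ z t → z + t - t ≡ z
  +--cancel = solve-∀

  -- Here and in `sub-head`, `z` is the class color of the tail, `p` the gain, and `s`, `t` the
  -- switching values at head and tail.
  add-head : ∀ z p s t → z + (p + s - t) ≡ (z - t + p) + s
  add-head = solve-∀

  sub-head : ∀ z p s t → z + (p + s - t) - s ≡ z - t + p
  sub-head = solve-∀

-- Lifting colorations along a top-vertex contraction

module Contraction {n} {i j : Fin (suc n)} (i≢j : i ≢ j) {g : ℤ} (0≤g : 0ℤ ≤ g) where

  η : Fin (suc n) → ℤ
  η v = if does (v Fin.≟ i) then g else 0ℤ

  η-top : η i ≡ g
  η-top with i Fin.≟ i
  ... | yes _   = refl
  ... | no  i≢i = contradiction refl i≢i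

  η-else : ∀ {v} → i ≢ v → η v ≡ 0ℤ
  η-else {v} i≢v with v Fin.≟ i
  ... | yes v≡i = contradiction (sym v≡i) i≢v
  ... | no  _   = refl

  η≥0 : ∀ v → 0ℤ ≤ η v
  η≥0 v with v Fin.≟ i
  ... | yes _ = 0≤g
  ... | no  _ = ℤ.≤-refl

  [_] : Fin (suc n) → Fin n
  [ v ] = merge i j i≢j v

  pull : Assignment n → Assignment (suc n)
  pull (r ∷ c) = r ∷ tabulate λ v → lookup c [ v ] - η v

  -- Each class is read off at its representative other than `i`, where `η` vanishes; for the merged
  -- vertex this is `j`. The color of `i` is forgotten.
  push : Assignment (suc n) → Assignment n
  push (r ∷ c) = r ∷ tabulate λ w → lookup c (punchIn i w)

  lookup-pull : ∀ y v → lookup (pull y) (suc v) ≡ lookup y (suc [ v ]) - η v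
  lookup-pull (_ ∷ c) v = Vec.lookup∘tabulate (λ v → lookup c [ v ] - η v) v

  lookup-pull-root : ∀ y → lookup (pull y) zero ≡ lookup y zero
  lookup-pull-root (_ ∷ _) = refl

  lookup-pull+η : ∀ y v → lookup (pull y) (suc v) + η v ≡ lookup y (suc [ v ])
  lookup-pull+η y v = trans (cong (_+ η v) (lookup-pull y v)) (-+-cancel _ (η v))

  lookup-pull-punchIn : ∀ y w → lookup (pull y) (suc (punchIn i w)) ≡ lookup y (suc w)
  lookup-pull-punchIn y w = begin
    lookup (pull y) (suc (punchIn i w))                     ≡⟨ lookup-pull y _ ⟩
    lookup y (suc [ punchIn i w ]) - η (punchIn i w)        ≡⟨ cong₂ (λ u s → lookup y (suc u) - s)
                                                                 (merge-punchIn i≢j w)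
                                                                 (η-else (Fin.punchInᵢ≢i i w ∘ sym)) ⟩
    lookup y (suc w) - 0ℤ                                   ≡⟨ ℤ.+-identityʳ _ ⟩
    lookup y (suc w)                                        ∎
    where open ≡-Reasoning

  push-pull : ∀ y → push (pull y) ≡ y
  push-pull y@(r ∷ c) = cong (r ∷_)
    (trans (Vec.tabulate-cong (lookup-pull-punchIn y)) (Vec.tabulate∘lookup c))

  pull-injective : Injective _≡_ _≡_ pull
  pull-injective {y} {y′} eq =
    trans (sym (push-pull y)) (trans (cong push eq) (push-pull y′))

  -- Both vertices inherit the same class color and only `i` is lowered, by `g`. So every lifted
  -- assignment violates the contracted edge, which gives the disjointness in the count.
  pull-top : ∀ y → lookup (pull y) (suc j) ≡ lookup (pull y) (suc i) + g
  pull-top y = begin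
    lookup (pull y) (suc j)        ≡⟨ lookup-pull y j ⟩
    lookup y (suc [ j ]) - η j     ≡⟨ cong (λ s → lookup y (suc [ j ]) - s) (η-else i≢j) ⟩
    lookup y (suc [ j ]) - 0ℤ      ≡⟨ ℤ.+-identityʳ _ ⟩
    lookup y (suc [ j ])           ≡⟨ cong (lookup y ∘ suc) (merge-identified i≢j) ⟨
    lookup y (suc [ i ])           ≡⟨ lookup-pull+η y i ⟨
    lookup (pull y) (suc i) + η i  ≡⟨ cong (λ s → lookup (pull y) (suc i) + s) η-top ⟩
    lookup (pull y) (suc i) + g    ∎
    where open ≡-Reasoning

  -- The violated edge condition determines the forgotten color of `i` from that of `j`; all other
  -- colors are kept.
  pull-push : ∀ x → lookup x (suc j) ≡ lookup x (suc i) + g → x ≡ pull (push x)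
  pull-push (r ∷ c) cj≡ci+g = cong (r ∷_)
    (trans (sym (Vec.tabulate∘lookup c)) (Vec.tabulate-cong same))
    where
    open ≡-Reasoning
    c′ : Vec ℤ n
    c′ = tabulate λ w → lookup c (punchIn i w)

    same : lookup c ≗ λ v → lookup c′ [ v ] - η v
    same v with i Fin.≟ v in eq
    ... | no i≢v = begin
      lookup c v                                ≡⟨ cong (lookup c) (Fin.punchIn-punchOut i≢v) ⟨
      lookup c (punchIn i (punchOut i≢v))       ≡⟨ Vec.lookup∘tabulate _ (punchOut i≢v) ⟨
      lookup c′ (punchOut i≢v)                  ≡⟨ ℤ.+-identityʳ _ ⟨
      lookup c′ (punchOut i≢v) - 0ℤ             ≡⟨ cong (λ s → lookup c′ (punchOut i≢v) - s) (η-else i≢v) ⟨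
      lookup c′ (punchOut i≢v) - η v            ∎
    ... | yes refl = begin
      lookup c i                                ≡⟨ +--cancel (lookup c i) g ⟨
      lookup c i + g - g                        ≡⟨ cong (_- g) cj≡ci+g ⟨
      lookup c j - g                            ≡⟨ cong₂ (λ u s → lookup c u - s) (Fin.punchIn-punchOut i≢j) η-top ⟨
      lookup c (punchIn i (punchOut i≢j)) - η i ≡⟨ cong (_- η i) (Vec.lookup∘tabulate _ (punchOut i≢j)) ⟨
      lookup c′ (punchOut i≢j) - η i            ∎

  module _ {k} (Φ : RootedGainGraph (suc n) k) {m : ℤ} (y : Assignment n) where

    private
      Φ/ : RootedGainGraph n k
      Φ/ = identify i j i≢j (switch η Φ)

      x : Assignment (suc n)
      x = pull y

    pull-proper⁺ : IsProperRootedColoration Φ/ m y → IsProperRootedColoration Φ m x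
    pull-proper⁺ (R@(rooted y₀≡0 bounded _) , proper) =
      rooted′ (trans (lookup-pull-root y) y₀≡0) bounded′ above , proper′
      where
      bounded′ : ∀ v → lookup x (suc v) ≤ m
      bounded′ v = begin
        lookup x (suc v)             ≡⟨ lookup-pull y v ⟩
        -- The only place where the nonnegativity of `g` enters.
        lookup y (suc [ v ]) - η v   ≤⟨ ℤ.i-j≤i _ (η v) {{nonNegative (η≥0 v)}} ⟩
        lookup y (suc [ v ])         ≤⟨ bounded [ v ] ⟩
        m                            ∎
        where open ℤ.≤-Reasoning

      above : ∀ v → h Φ v < lookup x (suc v)
      above v = begin-strict
        h Φ v                        ≡⟨ +--cancel (h Φ v) (η v) ⟨
        h Φ v + η v - η v            <⟨ ℤ.+-monoˡ-< (- η v) (ℤ.≤-<-trans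
                                          (h-identify-upper i≢j (switch η Φ) v) (above-h R [ v ])) ⟩
        lookup y (suc [ v ]) - η v   ≡⟨ lookup-pull y v ⟨
        lookup x (suc v)             ∎
        where open ℤ.≤-Reasoning

      proper′ : IsProper Φ x
      -- A violation at `a` in `x` becomes one in `y` for the switched gain: adding `η` back at both
      -- ends compensates the change of gain.
      proper′ a eq = proper a (begin
        lookup y (suc [ t ])                         ≡⟨ lookup-pull+η y t ⟨
        lookup x (suc t) + η t                       ≡⟨ cong (_+ η t) eq ⟩
        lookup x (suc s) + φ Φ a + η t               ≡⟨ cong (λ z → z + φ Φ a + η t) (lookup-pull y s) ⟩
        lookup y (suc [ s ]) - η s + φ Φ a + η t     ≡⟨ add-head (lookup y (suc [ s ])) (φ Φ a) (η t) (η s) ⟨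
        lookup y (suc [ s ]) + (φ Φ a + η t - η s)   ∎)
        where
        open ≡-Reasoning
        s = tail Φ a
        t = head Φ a

    pull-proper⁻ : IsProperRootedColoration Φ m x → IsProperRootedColoration Φ/ m y
    pull-proper⁻ (R@(rooted x₀≡0 bounded _) , proper) =
      rooted′ (trans (sym (lookup-pull-root y)) x₀≡0) bounded′ above , proper′
      where
      bounded′ : ∀ w → lookup y (suc w) ≤ m
      -- The color of `w` occurs unlowered in `x` at `punchIn i w`, so the bound there suffices.
      bounded′ w = subst (_≤ m) (lookup-pull-punchIn y w) (bounded (punchIn i w))

      above : ∀ w → h Φ/ w < lookup y (suc w)
      -- A member `v` attaining the maximum reduces the claim to one root inequality of `Φ`, shifted
      -- by `η v`.
      above w with h-identify-attained i≢j (switch η Φ) w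
      ... | v , refl , h≡ = begin-strict
        h Φ/ [ v ]               ≡⟨ h≡ ⟩
        h Φ v + η v              <⟨ ℤ.+-monoˡ-< (η v) (above-h R v) ⟩
        lookup x (suc v) + η v   ≡⟨ lookup-pull+η y v ⟩
        lookup y (suc [ v ])     ∎
        where open ℤ.≤-Reasoning

      proper′ : IsProper Φ/ y
      proper′ a eq = proper a (begin
        lookup x (suc t)                                   ≡⟨ lookup-pull y t ⟩
        lookup y (suc [ t ]) - η t                         ≡⟨ cong (_- η t) eq ⟩
        lookup y (suc [ s ]) + (φ Φ a + η t - η s) - η t   ≡⟨ sub-head (lookup y (suc [ s ])) (φ Φ a) (η t) (η s) ⟩
        lookup y (suc [ s ]) - η s + φ Φ a                 ≡⟨ cong (_+ φ Φ a) (lookup-pull y s) ⟨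
        lookup x (suc s) + φ Φ a                           ∎)
        where
        open ≡-Reasoning
        s = tail Φ a
        t = head Φ a

-- Orientations and properness at a single edge

module _ {V E} (Γ : GainGraph V E) where
  open GainGraph Γ using () renaming (φ to gain; φ-⁻¹ to gain-⁻¹)

  topOrientation-gain : ∀ e → 0ℤ ≤ gain (GainGraph.topOrientation Γ e)
  topOrientation-gain e with 0ℤ ℤ.≤? gain (e , false)
  ... | yes 0≤g = 0≤g
  ... | no  0≰g = subst (0ℤ ≤_) (sym (gain-⁻¹ (e , false))) (ℤ.neg-mono-≤ (ℤ.<⇒≤ (ℤ.≰⇒> 0≰g)))

module _ {n k} (Ψ : RootedGainGraph n k) (x : Assignment n) where

  ProperAt : Oriented (Fin k) → Set
  ProperAt a = lookup x (suc (head Ψ a)) ≢ lookup x (suc (tail Ψ a)) + φ Ψ a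

  -- Reversal swaps the ends and negates the gain, so both orientations impose the same condition;
  -- testing `e` in its top orientation alone is enough.
  properAt-⁻¹ : ∀ a → ProperAt a → ProperAt (a ⁻¹)
  properAt-⁻¹ a@(e , b) proper eq = proper (begin
    lookup x (suc (head Ψ a))                            ≡⟨ -+-cancel _ (φ Ψ a) ⟨
    lookup x (suc (head Ψ a)) - φ Ψ a + φ Ψ a            ≡⟨ cong (λ p → lookup x (suc (head Ψ a)) + p + φ Ψ a) (φ-⁻¹ Ψ a) ⟨
    lookup x (suc (head Ψ a)) + φ Ψ (a ⁻¹) + φ Ψ a       ≡⟨ cong (_+ φ Ψ a) eq ⟨
    lookup x (suc (head Ψ (a ⁻¹))) + φ Ψ a               ≡⟨ cong (λ c → lookup x (suc (tail Ψ (e , c))) + φ Ψ a) (not-involutive b) ⟩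
    lookup x (suc (tail Ψ a)) + φ Ψ a                    ∎)
    where open ≡-Reasoning

module _ {n k} (Ψ : RootedGainGraph n (suc k)) (e : Fin (suc k)) (x : Assignment n) where

  -- An edge other than `e` survives in `Ψ ∖ e` under the name given by `punchOut`; at `e` itself,
  -- one orientation yields the other.
  proper-insert : IsProper (Ψ ∖ e) x → ∀ b → ProperAt Ψ x (e , b) → IsProper Ψ x
  proper-insert proper b properₑ (f , b′) with e Fin.≟ f
  ... | no e≢f = subst (λ f → ProperAt Ψ x (f , b′)) (Fin.punchIn-punchOut e≢f)
                       (proper (punchOut e≢f , b′))
  proper-insert proper false properₑ (f , false) | yes refl = properₑ
  proper-insert proper false properₑ (f , true)  | yes refl = properAt-⁻¹ Ψ x (e , false) properₑ
  proper-insert proper true  properₑ (f , false) | yes refl = properAt-⁻¹ Ψ x (e , true) properₑ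
  proper-insert proper true  properₑ (f , true)  | yes refl = properₑ

-- Deletion and contraction

-- Counts are natural numbers, so the recurrence is first proved additively.
χᶻ-deletion : ∀ {n k} (Ψ : RootedGainGraph (suc n) (suc k)) e (link : IsLink Ψ e) m →
              χᶻ (Ψ ∖ e) m ≡ χᶻ Ψ m ℕ.+ χᶻ (contract Ψ e link) m
χᶻ-deletion Ψ e link m = card-disjoint-image
  (properRootedColorations Ψ m) (properRootedColorations (contract Ψ e link) m)
  (properRootedColorations (Ψ ∖ e) m) C.pull C.pull-injective
  (λ {y} _ (_ , proper) → proper a (C.pull-top y))
  λ x → mk⇔ (split x) λ
    { (inj₁ (R , proper))   → rooted-∖ R , λ (f , b) → proper (punchIn e f , b)
    -- Deleting `e` commutes by computation with switching and identification, so
    -- `contract Ψ e link` is the identified switching of `Ψ ∖ e`.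
    ; (inj₂ (y , q , refl)) → C.pull-proper⁺ (Ψ ∖ e) y q
    }
  where
  a = topOrientation Ψ e
  module C = Contraction (topOrientation-link Ψ e link) (topOrientation-gain (nonroot Ψ) e)

  rooted-∖ : ∀ {x} → IsRootedColoration Ψ m x → IsRootedColoration (Ψ ∖ e) m x
  rooted-∖ (rooted r b p) = rooted r b p

  split : ∀ x → IsProperRootedColoration (Ψ ∖ e) m x →
          IsProperRootedColoration Ψ m x ⊎
          ∃[ y ] (IsProperRootedColoration (contract Ψ e link) m y × x ≡ C.pull y)
  split x p@(rooted r b q , proper)
    with lookup x (suc (head Ψ a)) ℤ.≟ lookup x (suc (tail Ψ a)) + φ Ψ a
  ... | no  properₑ = inj₁ (rooted r b q , proper-insert Ψ e x proper (proj₂ a) properₑ)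
  -- `C.pull-proper⁻` speaks of lifted assignments, so `x` is first replaced by the lift of
  -- `C.push x`.
  ... | yes eq      = inj₂ (C.push x , C.pull-proper⁻ (Ψ ∖ e) (C.push x)
                              (subst (IsProperRootedColoration (Ψ ∖ e) m) x≡ p) , x≡)
    where
    x≡ = C.pull-push x eq

theorem3p4 : ∀ {n k : ℕ} (Ψ : RootedGainGraph (suc n) (suc k)) (e : Fin (suc k)) →
    (link : RootedGainGraph.IsLink Ψ e) → (m : ℤ) →
    + χᶻ Ψ m ≡ + χᶻ (Ψ ∖ e) m - + χᶻ (contract Ψ e link) m
theorem3p4 Ψ e link m = begin
  -- The sum under `+_` computes to the sum of the two integers, so cancellation in ℤ applies
  -- directly.
  + χᶻ Ψ m                                                               ≡⟨ +--cancel (+ χᶻ Ψ m) (+ χᶻ (contract Ψ e link) m) ⟨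
  + (χᶻ Ψ m ℕ.+ χᶻ (contract Ψ e link) m) - + χᶻ (contract Ψ e link) m   ≡⟨ cong (λ c → + c - + χᶻ (contract Ψ e link) m)
                                                                              (χᶻ-deletion Ψ e link m) ⟨
  + χᶻ (Ψ ∖ e) m - + χᶻ (contract Ψ e link) m                            ∎
  where open ≡-Reasoning
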